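{- Let $a$ and $b$ be positive integers. If $\frac{a}{b} < \frac{22}{5}$, then there exists a planar graph $G$ such that $G$ is not $(a:b)$-choosable.
   Context: All graphs are finite and simple. For an assignment $L$ of lists (finite sets) of colors to the vertices of a graph $G$, a $b$-fold $L$-coloring of $G$ is a mapping $\varphi$ that assigns to each vertex $v$ a set $\varphi(v)\subseteq L(v)$ with $|\varphi(v)| = b$, such that $\varphi(u)\cap\varphi(v)=\varnothing$ whenever $u$ and $v$ are adjacent. For positive integers $a,b$, a graph $G$ is $(a:b)$-choosable if, for each list assignment $L$ with $|L(v)| = a$ for every vertex $v$, $G$ admits a $b$-fold $L$-coloring. -}

module Defs where

open import Data.Fin.Base using (Fin)
open import Data.Fin.Subset using (Subset; _⊆_; _∩_; Empty; ∣_∣)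
open import Data.Nat.Base using (ℕ)
open import Data.Product.Base using (∃; _×_; _,_)
open import Data.Rational.Base using (ℚ; 0ℚ; 1ℚ; _+_; _*_; _-_; _≤_)
open import Data.Sum.Base using (_⊎_)
open import Function.Bundles using (_↔_)
open import Function.Definitions using (Injective)
open import Level using (0ℓ)
open import Relation.Binary.Core using (Rel)
open import Relation.Binary.Definitions using (Symmetric; Irreflexive; Decidable)
open import Relation.Binary.PropositionalEquality.Core using (_≡_; _≢_)

record Graph : Set₁ where
  field
    Vertex     : Set
    order      : ℕ
    enumerate  : Vertex ↔ Fin order
    Adj        : Rel Vertex 0ℓ
    adj?       : Decidable Adj
    adj-sym    : Symmetric Adj
    adj-irrefl : Irreflexive _≡_ Adj

-- The colors are the elements of Fin n.  Choosability below quantifies over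
-- all n; since graphs and lists are finite, only finitely many colors occur in
-- a list assignment, so no assignment is lost.

ListAssignment : Graph → ℕ → Set
ListAssignment G n = Graph.Vertex G → Subset n

record FoldColoring (G : Graph) {n : ℕ} (L : ListAssignment G n) (b : ℕ) : Set where
  open Graph G
  field
    φ        : Vertex → Subset n
    φ⊆L      : ∀ v → φ v ⊆ L v
    size     : ∀ v → ∣ φ v ∣ ≡ b
    disjoint : ∀ {u v} → Adj u v → Empty (φ u ∩ φ v)

Choosable : Graph → ℕ → ℕ → Set
Choosable G a b =
  ∀ {n} (L : ListAssignment G n) → (∀ v → ∣ L v ∣ ≡ a) → FoldColoring G L b

-- Planarity is the existence of a drawing in the plane without crossings in
-- which every edge is a polygonal arc.  All coordinates are rational.  This
-- loses nothing: a finite planar graph has such a drawing, and two segments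
-- with rational endpoints that meet over ℝ already meet in a rational point
-- (and in only one rational point if and only if in only one real point), so
-- the conditions below, read over ℚ, say the same as over ℝ.

Point : Set
Point = ℚ × ℚ

between : Point → Point → ℚ → Point
between (x₁ , y₁) (x₂ , y₂) t =
  ((1ℚ - t) * x₁ + t * x₂) , ((1ℚ - t) * y₁ + t * y₂)

_∈[_,_] : Point → Point → Point → Set
p ∈[ q , r ] = ∃ λ t → 0ℚ ≤ t × t ≤ 1ℚ × p ≡ between q r t

data Polyline : Point → Point → Set where
  segment : ∀ p q → Polyline p q
  _∷_     : ∀ p {q r} → Polyline q r → Polyline p r

_∈ₚ_ : ∀ {q r} → Point → Polyline q r → Set
x ∈ₚ segment p q   = x ∈[ p , q ]
x ∈ₚ (_∷_ p {q} P) = x ∈[ p , q ] ⊎ x ∈ₚ P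

-- A polyline is an arc if it does not intersect itself: no segment is
-- degenerate, and each one meets the remainder only in their common breakpoint.
IsArc : ∀ {p r} → Polyline p r → Set
IsArc (segment p q)   = p ≢ q
IsArc (_∷_ p {q} P) =
  p ≢ q × (∀ x → x ∈[ p , q ] → x ∈ₚ P → x ≡ q) × IsArc P

SameEnds : {V : Set} → V → V → V → V → Set
SameEnds u v x y = (u ≡ x × v ≡ y) ⊎ (u ≡ y × v ≡ x)

record PlaneDrawing (G : Graph) : Set where
  open Graph G
  field
    pos           : Vertex → Point
    pos-injective : Injective _≡_ _≡_ pos
    line          : ∀ {u v} → Adj u v → Polyline (pos u) (pos v)
    line-arc      : ∀ {u v} (e : Adj u v) → IsArc (line e)

    -- An edge is given once in each direction (and once for every proof of
    -- adjacency); all of these describe the same point set.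
    line-sym      : ∀ {u v} (e : Adj u v) (f : Adj v u) {p} →
                    p ∈ₚ line e → p ∈ₚ line f

    -- The interior of an edge contains no vertex and no point of another edge.
    vertex-on-line : ∀ {u v} (e : Adj u v) w →
                     pos w ∈ₚ line e → w ≡ u ⊎ w ≡ v
    lines-meet     : ∀ {u v x y} (e : Adj u v) (f : Adj x y) {p} →
                     p ∈ₚ line e → p ∈ₚ line f →
                     SameEnds u v x y ⊎ (∃ λ w → p ≡ pos w)

Planar : Graph → Set
Planar = PlaneDrawing

-- Two hubs with disjoint lists are joined to many copies of a gadget with 14
-- vertices, one copy for every possible pair (X, Y) of color sets of the hubs;
-- the lists in that copy contain X at the neighbors of the first hub and Y at
-- those of the second.  In the copy made for the sets that a coloring really
-- uses, these colors are lost, so 14 b occurrences of fresh colors are needed.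
-- A fresh color occurs at most as often as the part of the gadget having it in
-- its lists can be covered by cliques.  With a = 4 b + e the fresh colors form
-- six classes of b colors, with clique covers of 1 + 2 + 2 + 4 + 1 + 2 = 12
-- cliques altogether, and one class of e colors, with a cover of 5 cliques;
-- hence 14 b ≤ 12 b + 5 e, which means 22 b ≤ 5 a.
--
-- The copies are drawn as the images of one straight-line drawing under the maps
-- (x , y) ↦ (x , 2ᵏ y).  These fix the hubs (± 100 , 0), and copy k lies between
-- the tents of heights 100 · 2ᵏ and 200 · 2ᵏ spanned over the two hubs.
module Submission where

open import Defs

-- Finite sums, sizes of subsets, and bounds by clique covers.

module Counting where

  open import Data.Nat.Base
  open import Data.Nat.Properties hiding (suc-injective)
  open import Algebra.Properties.Semiring.Sum +-*-semiring public
    using (sum; ∑-comm; ∑-distrib-+; sum-cong-≗; *-distribʳ-sum)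
  open import Data.Bool.Base using (Bool; if_then_else_)
  open import Data.Fin.Base using (Fin; zero; suc; _↑ˡ_; _↑ʳ_)
  open import Data.Fin.Properties using (suc-injective)
  open import Data.Fin.Subset using (Subset; _∈_; _⊆_; ∣_∣; inside; outside)
  open import Data.Fin.Subset.Properties using (_∈?_; ∣⊥∣≡0; ∣⊤∣≡n)
  open import Data.List.Base using (List; []; _∷_; length)
  import Data.List.Membership.Propositional as List
  open import Data.List.Relation.Unary.All as All using (All; []; _∷_)
  open import Data.List.Relation.Unary.Any as Any using (Any; here; there)
  open import Data.Product.Base using (∃; _×_; _,_; proj₂)
  open import Data.Vec.Base using ([]; _∷_; lookup; replicate; _[_]≔_; _++_)
    renaming (here to hereᵛ; there to thereᵛ)
  open import Data.Vec.Properties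
    using (lookup-++ˡ; lookup-++ʳ; lookup∘update; lookup∘update′; []=⇒lookup; lookup⇒[]=)
  open import Function.Base using (_∘_; id)
  open import Relation.Binary.PropositionalEquality
  open import Relation.Nullary.Decidable using (yes; no)
  open import Relation.Nullary.Negation.Core using (contradiction)

  sum-const : ∀ n x → sum {n} (λ _ → x) ≡ n * x
  sum-const zero    x = refl
  sum-const (suc n) x = cong (x +_) (sum-const n x)

  sum-mono-≤ : ∀ {n} {f g : Fin n → ℕ} → (∀ i → f i ≤ g i) → sum f ≤ sum g
  sum-mono-≤ {zero}  f≤g = z≤n
  sum-mono-≤ {suc n} f≤g = +-mono-≤ (f≤g zero) (sum-mono-≤ (f≤g ∘ suc))

  sum-zero : ∀ {n} {f : Fin n → ℕ} → (∀ i → f i ≡ 0) → sum f ≡ 0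
  sum-zero {n} f≡0 = trans (sum-cong-≗ f≡0) (trans (sum-const n 0) (*-zeroʳ n))

  sum-single : ∀ {n} {f : Fin n → ℕ} i → (∀ j → j ≢ i → f j ≡ 0) → sum f ≡ f i
  sum-single {f = f} zero    f≡0 = trans (cong (f zero +_) (sum-zero (λ j → f≡0 (suc j) λ ()))) (+-identityʳ _)
  sum-single         (suc i) f≡0 = cong₂ _+_ (f≡0 zero λ ()) (sum-single i λ j j≢i → f≡0 (suc j) (j≢i ∘ suc-injective))

  sum-linear : ∀ {n} (f g : Fin n → ℕ) x y → sum (λ i → f i * x + g i * y) ≡ sum f * x + sum g * y
  sum-linear f g x y = trans (∑-distrib-+ (λ i → f i * x) (λ i → g i * y))
    (sym (cong₂ _+_ (*-distribʳ-sum x f) (*-distribʳ-sum y g)))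

  sum-++ : ∀ m {n} (f : Fin (m + n) → ℕ) → sum f ≡ sum (λ i → f (i ↑ˡ n)) + sum (λ j → f (m ↑ʳ j))
  sum-++ zero    f = refl
  sum-++ (suc m) f = trans (cong (f zero +_) (sum-++ m (f ∘ suc))) (sym (+-assoc (f zero) _ _))

  bit : Bool → ℕ
  bit b = if b then 1 else 0

  bit≡0 : ∀ {b} → b ≢ inside → bit b ≡ 0
  bit≡0 {inside}  b≢ = contradiction refl b≢
  bit≡0 {outside} _  = refl

  ∣∣≡sum : ∀ {n} (p : Subset n) → ∣ p ∣ ≡ sum (λ i → bit (lookup p i))
  ∣∣≡sum []            = refl
  ∣∣≡sum (inside ∷ p)  = cong suc (∣∣≡sum p)
  ∣∣≡sum (outside ∷ p) = ∣∣≡sum p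

  ∣replicate∣ : ∀ n b → ∣ replicate n b ∣ ≡ bit b * n
  ∣replicate∣ n inside  = trans (∣⊤∣≡n n) (sym (*-identityˡ n))
  ∣replicate∣ n outside = ∣⊥∣≡0 n

  ∣++∣ : ∀ {m n} (p : Subset m) (q : Subset n) → ∣ p ++ q ∣ ≡ ∣ p ∣ + ∣ q ∣
  ∣++∣ []            q = refl
  ∣++∣ (inside ∷ p)  q = cong suc (∣++∣ p q)
  ∣++∣ (outside ∷ p) q = ∣++∣ p q

  -- Colors come in consecutive blocks: `Fin (sum size)` stands for the disjoint union of the
  -- `Fin (size i)`, with `color` as the injection of a block and `paint` assembling a subset from
  -- its traces on the blocks.
  color : ∀ {m} (size : Fin m → ℕ) i → Fin (size i) → Fin (sum size)
  color size zero    c = c ↑ˡ _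
  color size (suc i) c = size zero ↑ʳ color (size ∘ suc) i c

  paint : ∀ {m} (size : Fin m → ℕ) → (∀ i → Subset (size i)) → Subset (sum size)
  paint {zero}  size f = []
  paint {suc m} size f = f zero ++ paint (size ∘ suc) (λ i → f (suc i))

  lookup-paint : ∀ {m} (size : Fin m → ℕ) f i c → lookup (paint size f) (color size i c) ≡ lookup (f i) c
  lookup-paint size f zero    c = lookup-++ˡ (f zero) _ c
  lookup-paint size f (suc i) c = trans (lookup-++ʳ (f zero) _ _) (lookup-paint (size ∘ suc) (λ i → f (suc i)) i c)

  ∣paint∣ : ∀ {m} (size : Fin m → ℕ) f → ∣ paint size f ∣ ≡ sum (λ i → ∣ f i ∣)
  ∣paint∣ {zero}  size f = refl
  ∣paint∣ {suc m} size f = trans (∣++∣ (f zero) _) (cong (∣ f zero ∣ +_) (∣paint∣ (size ∘ suc) (λ i → f (suc i))))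

  sum-colors : ∀ {m} (size : Fin m → ℕ) (g : Fin (sum size) → ℕ) → sum g ≡ sum (λ i → sum (λ c → g (color size i c)))
  sum-colors {zero}  size g = refl
  sum-colors {suc m} size g = trans (sum-++ (size zero) g)
    (cong (sum (λ c → g (color size zero c)) +_) (sum-colors (size ∘ suc) (g ∘ (size zero ↑ʳ_))))

  ∣∣≤1+∣≔∣ : ∀ {n} (p : Subset n) i → ∣ p ∣ ≤ suc ∣ p [ i ]≔ outside ∣
  ∣∣≤1+∣≔∣ (inside ∷ p)  zero    = ≤-refl
  ∣∣≤1+∣≔∣ (outside ∷ p) zero    = n≤1+n _
  ∣∣≤1+∣≔∣ (inside ∷ p)  (suc i) = s≤s (∣∣≤1+∣≔∣ p i)
  ∣∣≤1+∣≔∣ (outside ∷ p) (suc i) = ∣∣≤1+∣≔∣ p i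

  ∈≔⇒ : ∀ {n} {p : Subset n} {i j} → j ∈ p [ i ]≔ outside → j ≢ i × j ∈ p
  ∈≔⇒ {p = p} {i} {j} j∈ = j≢i , lookup⇒[]= j p (trans (sym (lookup∘update′ j≢i p outside)) ([]=⇒lookup j∈))
    where
    j≢i : j ≢ i
    j≢i refl with () ← trans (sym ([]=⇒lookup j∈)) (lookup∘update i p outside)

  -- Each list `K` holds at most one element of `p`. Once that element, if any, is deleted, the
  -- remaining lists cover what is left, so every list accounts for at most one unit of size.
  ∣∣≤cover : ∀ {n} (p : Subset n) (C : List (List (Fin n))) →
    (∀ {i} → i ∈ p → Any (i List.∈_) C) →
    All (λ K → ∀ i j → i List.∈ K → j List.∈ K → i ∈ p → j ∈ p → i ≡ j) C →
    ∣ p ∣ ≤ length C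
  ∣∣≤cover p [] covers _ = ≤-reflexive (trans (∣∣≡sum p) (sum-zero λ i → bit≡0 (absent i)))
    where
    absent : ∀ i → lookup p i ≢ inside
    absent i eq with () ← covers (lookup⇒[]= i p eq)
  ∣∣≤cover p (K ∷ C) covers (single ∷ singles) with Any.any? (_∈? p) K
  ... | no  none = ≤-trans (∣∣≤cover p C (λ i∈ → skip i∈ (covers i∈)) singles) (n≤1+n _)
    where
    skip : ∀ {i} → i ∈ p → Any (i List.∈_) (K ∷ C) → Any (i List.∈_) C
    skip i∈ (here i∈K) = contradiction (Any.map (λ { refl → i∈ }) i∈K) none
    skip i∈ (there i∈C) = i∈C
  ... | yes some with List.find some
  ... | k , k∈K , k∈p = ≤-trans (∣∣≤1+∣≔∣ p k) (s≤s (∣∣≤cover (p [ k ]≔ outside) C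
      -- An element of the smaller set differs from `k`, so it cannot lie in `K` and a later list
      -- has to cover it.
      (λ i∈ → skip (∈≔⇒ i∈) (covers (proj₂ (∈≔⇒ i∈))))
      (All.map (λ single i j i∈K j∈K i∈ j∈ → single i j i∈K j∈K (proj₂ (∈≔⇒ i∈)) (proj₂ (∈≔⇒ j∈))) singles)))
    where
    skip : ∀ {i} → i ≢ k × i ∈ p → Any (i List.∈_) (K ∷ C) → Any (i List.∈_) C
    skip (i≢k , i∈p) (here i∈K) = contradiction (single _ k i∈K k∈K i∈p k∈p) i≢k
    skip _ (there i∈C) = i∈C

  -- Serves `choose-larger`, where lists have to be trimmed to a prescribed length.
  shrink : ∀ {n} (p : Subset n) m → m ≤ ∣ p ∣ → ∃ λ q → q ⊆ p × ∣ q ∣ ≡ m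
  shrink []            zero    _        = [] , id , refl
  shrink (outside ∷ p) m       m≤       =
    let q , q⊆p , eq = shrink p m m≤
    in outside ∷ q , (λ { (thereᵛ i∈) → thereᵛ (q⊆p i∈) }) , eq
  shrink (inside ∷ p)  zero    _        =
    let q , q⊆p , eq = shrink p zero z≤n
    in outside ∷ q , (λ { (thereᵛ i∈) → thereᵛ (q⊆p i∈) }) , eq
  shrink (inside ∷ p)  (suc m) (s≤s m≤) =
    let q , q⊆p , eq = shrink p m m≤
    in inside ∷ q , (λ { hereᵛ → hereᵛ ; (thereᵛ i∈) → thereᵛ (q⊆p i∈) }) , cong suc eq

-- The gadget, its straight-line drawing, and the finite checks on both.

module Gadget where

  open import Data.Bool.Base using (Bool; true)
  open import Data.Fin.Base using (Fin; suc)
  open import Data.Fin.Patterns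
  open import Data.Fin.Properties using () renaming (_≟_ to _≟ᶠ_; all? to allFin?; any? to anyFin?)
  open import Data.Integer.Base
  open import Data.Integer.Properties
  open import Data.List.Base using (List; []; _∷_; _++_; map)
  open import Data.List.Membership.Propositional using (_∈_)
  open import Data.List.Relation.Unary.All using (All; all?)
  open import Data.List.Relation.Unary.Any using (Any; any?)
  open import Data.Nat.Base as ℕ using (ℕ)
  import Data.Nat.Properties as ℕ
  open import Data.Product.Base using (∃; _×_; _,_; proj₂)
  open import Data.Product.Properties using () renaming (≡-dec to ×-≡-dec)
  open import Data.Sum.Base using (_⊎_; inj₁; inj₂)
  open import Data.Sum.Properties using () renaming (≡-dec to ⊎-≡-dec)
  open import Data.Vec.Base using (Vec; []; _∷_; lookup)
  open import Relation.Binary.Definitions using (DecidableEquality)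
  open import Relation.Binary.PropositionalEquality
  open import Relation.Nullary.Decidable
    using (Dec; does; yes; no; map′; _×-dec_; _⊎-dec_; _→-dec_; ¬?; toWitness)
  open Counting using (bit; sum)

  -- The left summand holds the two hubs, the right one the inner vertices of a single copy.
  Site : Set
  Site = Fin 2 ⊎ Fin 14

  pattern 10F = suc 9F
  pattern 11F = suc 10F
  pattern 12F = suc 11F
  pattern 13F = suc 12F

  _≟ˢ_ : DecidableEquality Site
  _≟ˢ_ = ⊎-≡-dec _≟ᶠ_ _≟ᶠ_

  -- Sorted by adjacent hubs: both for `middle`, only the hub at (100 , 0) for `east`, only the one
  -- at (-100 , 0) for `west`.
  middle east west : List (Fin 14)
  middle = 0F ∷ 3F ∷ 6F ∷ 7F ∷ 10F ∷ 13F ∷ []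
  east   = 1F ∷ 4F ∷ 8F ∷ 11F ∷ []
  west   = 2F ∷ 5F ∷ 9F ∷ 12F ∷ []

  -- Four diamonds (two triangles on a common edge) in a row; the first two share vertex 3, the last
  -- two share vertex 10, and the edge from 6 to 7 links the pairs.
  innerEdges : List (Fin 14 × Fin 14)
  innerEdges =
    (0F , 1F) ∷ (0F , 2F) ∷ (1F , 2F) ∷ (1F , 3F) ∷ (2F , 3F) ∷
    (3F , 4F) ∷ (3F , 5F) ∷ (4F , 5F) ∷ (4F , 6F) ∷ (5F , 6F) ∷
    (6F , 7F) ∷
    (7F , 8F) ∷ (7F , 9F) ∷ (8F , 9F) ∷ (8F , 10F) ∷ (9F , 10F) ∷
    (10F , 11F) ∷ (10F , 12F) ∷ (11F , 12F) ∷ (11F , 13F) ∷ (12F , 13F) ∷ []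

  Edge : Set
  Edge = Site × Site

  -- Unfolded only for the finite checks below; elsewhere comparing types would
  -- expand the 41 edges again and again.
  opaque

    edges : List Edge
    edges =
      map (λ k → inj₁ 0F , inj₂ k) (middle ++ east) ++
      map (λ k → inj₁ 1F , inj₂ k) (middle ++ west) ++
      map (λ (k , l) → inj₂ k , inj₂ l) innerEdges

  GridPoint : Set
  GridPoint = ℤ × ℤ

  -- A narrow column, ascending with the index. Where x is between -1 and 1, the floor is at height
  -- at most 100 and the ceiling at height at least 198, which leaves room for the heights 102 to
  -- 128.
  innerPoint : Vec GridPoint 14
  innerPoint =
    (+ 0 , + 102) ∷ (+ 1 , + 104) ∷ (- + 1 , + 105) ∷ (+ 0 , + 108) ∷ (+ 1 , + 110) ∷ (- + 1 , + 111) ∷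
    (+ 0 , + 114) ∷ (+ 0 , + 116) ∷ (+ 1 , + 118) ∷ (- + 1 , + 119) ∷ (+ 0 , + 122) ∷ (+ 1 , + 124) ∷
    (- + 1 , + 125) ∷ (+ 0 , + 128) ∷ []

  grid : Site → GridPoint
  grid (inj₁ 0F) = + 100 , + 0
  grid (inj₁ 1F) = - + 100 , + 0
  grid (inj₂ k)  = lookup innerPoint k

  Affineℤ : Set
  Affineℤ = ℤ × ℤ × ℤ

  ⟦_⟧ℤ : Affineℤ → GridPoint → ℤ
  ⟦ α , β , γ ⟧ℤ (x , y) = α * x + β * y + γ

  -- With a, b the values of an affine function at the ends of one segment and c, d
  -- those at the ends of another: the segments meet at most in an end of the first.
  Separatedℤ : (a b c d : ℤ) → Set
  Separatedℤ a b c d =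
    (0ℤ ≤ a × 0ℤ ≤ b) × (c ≤ 0ℤ × d ≤ 0ℤ) × ((0ℤ < a ⊎ 0ℤ < b) ⊎ (c < 0ℤ × d < 0ℤ))

  separatedℤ? : ∀ a b c d → Dec (Separatedℤ a b c d)
  separatedℤ? a b c d =
    ((0ℤ ≤? a) ×-dec (0ℤ ≤? b)) ×-dec ((c ≤? 0ℤ) ×-dec (d ≤? 0ℤ)) ×-dec
    (((0ℤ <? a) ⊎-dec (0ℤ <? b)) ⊎-dec ((c <? 0ℤ) ×-dec (d <? 0ℤ)))

  -- The value at a point p is the cross product of the vectors from the first point to the second
  -- and to p. Its sign tells the side of the line, and swapping the two points negates it.
  through : GridPoint → GridPoint → Affineℤ
  through (x₁ , y₁) (x₂ , y₂) = y₁ - y₂ , x₂ - x₁ , x₁ * y₂ - x₂ * y₁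

  Splits : Edge → Edge → Affineℤ → Set
  Splits (a , b) (c , d) f =
    Separatedℤ (⟦ f ⟧ℤ (grid a)) (⟦ f ⟧ℤ (grid b)) (⟦ f ⟧ℤ (grid c)) (⟦ f ⟧ℤ (grid d))

  splits? : ∀ e e′ f → Dec (Splits e e′ f)
  splits? (a , b) (c , d) f = separatedℤ? _ _ _ _

  -- The candidates for a separating line: the lines carrying the two edges. Both orientations occur
  -- because `Splits` fixes which edge is on the nonnegative side.
  lines : Edge → Edge → List Affineℤ
  lines (a , b) (c , d) =
    through (grid c) (grid d) ∷ through (grid d) (grid c) ∷
    through (grid a) (grid b) ∷ through (grid b) (grid a) ∷ []

  _≟ᵉ_ : DecidableEquality Edge
  _≟ᵉ_ = ×-≡-dec _≟ˢ_ _≟ˢ_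

  -- The tent of height 100 h is the minimum over σ of the two lines
  -- y + h · margin σ = 0; h = 1 gives the floor and h = 2 the ceiling of a copy.
  -- So an edge above one line of the floor is above the floor, but an edge below
  -- the ceiling has to be below both of its lines.
  side : Fin 2 → ℤ
  side 0F = 1ℤ
  side 1F = -1ℤ

  margin : Fin 2 → GridPoint → ℤ
  margin σ (x , _) = side σ * x + - + 100

  overFloor overCeiling : Fin 2 → Site → ℤ
  overFloor σ a = proj₂ (grid a) + margin σ (grid a)
  overCeiling σ a = proj₂ (grid a) + (margin σ (grid a) + margin σ (grid a))

  Above Below : Fin 2 → Edge → Set
  Above σ (a , b) = (0ℤ ≤ overFloor σ a × 0ℤ ≤ overFloor σ b) × (0ℤ < overFloor σ a ⊎ 0ℤ < overFloor σ b)
  Below σ (a , b) = (overCeiling σ a ≤ 0ℤ × overCeiling σ b ≤ 0ℤ) × (overCeiling σ a < 0ℤ ⊎ overCeiling σ b < 0ℤ)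

  above? : ∀ σ e → Dec (Above σ e)
  above? σ (a , b) = ((_ ≤? _) ×-dec (_ ≤? _)) ×-dec ((_ <? _) ⊎-dec (_ <? _))

  below? : ∀ σ e → Dec (Below σ e)
  below? σ (a , b) = ((_ ≤? _) ×-dec (_ ≤? _)) ×-dec ((_ <? _) ⊎-dec (_ <? _))

  -- The hubs lie on every tent, but inner vertices are strictly between floor and ceiling. This
  -- strictness keeps inner vertices of different copies apart.
  inner-above : ∀ k → 0ℤ < overFloor 0F (inj₂ k)
  inner-above = toWitness {a? = allFin? λ k → _ <? _} _

  inner-below : ∀ k → overCeiling 0F (inj₂ k) < 0ℤ
  inner-below = toWitness {a? = allFin? λ k → _ <? _} _

  site-all? : ∀ {p} {P : Site → Set p} → (∀ a → Dec (P a)) → Dec (∀ a → P a)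
  site-all? P? = map′
    (λ (f , g) → λ { (inj₁ h) → f h ; (inj₂ k) → g k })
    (λ f → (λ h → f (inj₁ h)) , (λ k → f (inj₂ k)))
    (allFin? (λ h → P? (inj₁ h)) ×-dec allFin? (λ k → P? (inj₂ k)))

  -- Since the margin is nonpositive, raising a tent can only lower the value of its lines at a
  -- vertex; `lower-level` rests on this.
  between-hubs : ∀ a σ → margin σ (grid a) ≤ 0ℤ
  between-hubs = toWitness {a? = site-all? λ a → allFin? λ σ → _ ≤? _} _

  grid-injective : ∀ a b → grid a ≡ grid b → a ≡ b
  grid-injective = toWitness {a? = site-all? λ a → site-all? λ b →
    ×-≡-dec _≟_ _≟_ (grid a) (grid b) →-dec (a ≟ˢ b)} _

  near : Fin 2 → Fin 14 → Bool
  near h k = does (any? ((inj₁ h , inj₂ k) ≟ᵉ_) edges)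

  near⇒edge : ∀ h k → near h k ≡ true → (inj₁ h , inj₂ k) ∈ edges
  near⇒edge h k _ with any? ((inj₁ h , inj₂ k) ≟ᵉ_) edges
  near⇒edge h k _ | yes h∈ = h∈

  -- The vertices having the fresh colors of class t in their lists, as a union of
  -- cliques.
  cover : Fin 7 → List (List (Fin 14))
  cover 0F = (0F ∷ 1F ∷ 2F ∷ []) ∷ []
  cover 1F = (0F ∷ 1F ∷ 2F ∷ []) ∷ (3F ∷ 4F ∷ 5F ∷ []) ∷ []
  cover 2F = (4F ∷ 5F ∷ 6F ∷ []) ∷ (7F ∷ 8F ∷ 9F ∷ []) ∷ []
  cover 3F = (1F ∷ 2F ∷ 3F ∷ []) ∷ (4F ∷ 5F ∷ 6F ∷ []) ∷ (7F ∷ 8F ∷ 9F ∷ []) ∷ (10F ∷ 11F ∷ 12F ∷ []) ∷ []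
  cover 4F = (11F ∷ 12F ∷ 13F ∷ []) ∷ []
  cover 5F = (8F ∷ 9F ∷ 10F ∷ []) ∷ (11F ∷ 12F ∷ 13F ∷ []) ∷ []
  cover 6F = (0F ∷ 1F ∷ 2F ∷ []) ∷ (3F ∷ 4F ∷ 5F ∷ []) ∷ (6F ∷ 7F ∷ []) ∷ (8F ∷ 9F ∷ 10F ∷ []) ∷ (11F ∷ 12F ∷ 13F ∷ []) ∷ []

  covers : Fin 7 → Fin 14 → Bool
  covers t k = does (any? (any? (k ≟ᶠ_)) (cover t))

  covers⇒∈ : ∀ t k → covers t k ≡ true → Any (k ∈_) (cover t)
  covers⇒∈ t k _ with any? (any? (k ≟ᶠ_)) (cover t)
  covers⇒∈ t k _ | yes k∈ = k∈

  Joined : Fin 14 → Fin 14 → Set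
  Joined k l = (inj₂ k , inj₂ l) ∈ edges ⊎ (inj₂ l , inj₂ k) ∈ edges

  -- Class t consists of β t * b + ε t * e fresh colors.
  β ε : Fin 7 → ℕ
  β 6F = 0
  β _  = 1
  ε 6F = 1
  ε _  = 0

  opaque

    unfolding edges

    edges-split : All (λ e → All (λ e′ → e ≡ e′ ⊎ Any (Splits e e′) (lines e e′)) edges) edges
    edges-split = toWitness {a? =
      all? (λ e → all? (λ e′ → (e ≟ᵉ e′) ⊎-dec any? (splits? e e′) (lines e e′)) edges) edges} _

    edges-above : All (λ e → ∃ λ σ → Above σ e) edges
    edges-above = toWitness {a? = all? (λ e → anyFin? λ σ → above? σ e) edges} _

    edges-below : All (λ e → ∀ σ → Below σ e) edges
    edges-below = toWitness {a? = all? (λ e → allFin? λ σ → below? σ e) edges} _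

    edges-proper : All (λ (a , b) → a ≢ b) edges
    edges-proper = toWitness {a? = all? (λ (a , b) → ¬? (a ≟ˢ b)) edges} _

    -- Together with `hub-edge`, this makes every vertex an end of some edge, so that a vertex lying
    -- on an edge becomes a case of two edges meeting.
    edge-at : ∀ k → (inj₁ 0F , inj₂ k) ∈ edges ⊎ (inj₁ 1F , inj₂ k) ∈ edges
    edge-at = toWitness {a? = allFin? λ k → any? (_ ≟ᵉ_) edges ⊎-dec any? (_ ≟ᵉ_) edges} _

    hub-edge : ∀ h → ∃ λ k → (inj₁ h , inj₂ k) ∈ edges
    hub-edge = toWitness {a? = allFin? λ h → anyFin? λ k → any? (_ ≟ᵉ_) edges} _

    cover-cliques : ∀ t → All (λ K → All (λ k → All (λ l → k ≡ l ⊎ Joined k l) K) K) (cover t)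
    cover-cliques = toWitness {a? = allFin? λ t → all? (λ K → all? (λ k → all? (λ l →
      (k ≟ᶠ l) ⊎-dec any? ((inj₂ k , inj₂ l) ≟ᵉ_) edges ⊎-dec any? ((inj₂ l , inj₂ k) ≟ᵉ_) edges) K) K) (cover t)} _

    -- The list of an inner vertex receives b colors from each adjacent hub and b from each of the
    -- first six classes that covers it, four times b in all. The remaining e colors come from the
    -- last class, whose cover partitions the inner vertices (`row-ε`).
    row-β : ∀ k → sum (λ h → bit (near h k)) ℕ.+ sum (λ t → bit (covers t k) ℕ.* β t) ≡ 4
    row-β = toWitness {a? = allFin? λ k → _ ℕ.≟ 4} _

    row-ε : ∀ k → sum (λ t → bit (covers t k) ℕ.* ε t) ≡ 1
    row-ε = toWitness {a? = allFin? λ k → _ ℕ.≟ 1} _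

-- Separating lines over the rationals, and how scaled copies of the drawing meet.

module Planarity where

  open import Data.Fin.Base using (Fin; toℕ)
  open import Data.Fin.Patterns
  import Data.Fin.Properties as Fin
  open import Data.Integer.Base as ℤ using (ℤ; +_; 0ℤ)
  import Data.Integer.Properties as ℤ
  open import Data.List.Membership.Propositional using (_∈_; find; lose)
  open import Data.List.Relation.Unary.All as All using (All)
  open import Data.List.Relation.Unary.Any as Any using (Any)
  open import Data.Nat.Base as ℕ using (ℕ; zero; suc)
  import Data.Nat.Properties as ℕ
  open import Data.Product.Base as Product using (∃; _×_; _,_; proj₁; proj₂)
  open import Data.Product.Properties using (,-injectiveˡ; ,-injectiveʳ) renaming (≡-dec to ×-≡-dec)
  open import Data.Rational.Base
  open import Data.Rational.Literals using (fromℤ)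
  open import Data.Rational.Properties
  open import Data.Rational.Solver
  import Data.Rational.Unnormalised.Base as ℚᵘ
  import Data.Rational.Unnormalised.Properties as ℚᵘ
  open import Data.Sum.Base as Sum using (_⊎_; inj₁; inj₂; [_,_]′)
  open import Data.Sum.Function.Propositional using (_⊎-↔_)
  open import Data.Sum.Properties using () renaming (≡-dec to ⊎-≡-dec)
  open import Function.Base using (_∘_; id)
  open import Function.Construct.Composition using (_↔-∘_)
  open import Function.Construct.Identity using (↔-id)
  open import Function.Construct.Symmetry using (↔-sym)
  open import Function.Definitions using (Injective)
  open import Relation.Binary.Definitions using (DecidableEquality; tri<; tri≈; tri>)
  open import Relation.Binary.PropositionalEquality hiding ([_])
  open import Relation.Nullary.Decidable using (_×-dec_; _⊎-dec_)
  open import Relation.Nullary.Negation.Core using (contradiction)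
  open Gadget
  open +-*-Solver using (solve; _:=_; :-_; _:+_; _:*_; _:-_; con)

  fromℤ-+ : ∀ m n → fromℤ (m ℤ.+ n) ≡ fromℤ m + fromℤ n
  fromℤ-+ m n = toℚᵘ-injective (ℚᵘ.≃-trans
    (ℚᵘ.*≡* (cong₂ (λ x y → (x ℤ.+ y) ℤ.* (+ 1)) (sym (ℤ.*-identityʳ m)) (sym (ℤ.*-identityʳ n))))
    (ℚᵘ.≃-sym (toℚᵘ-homo-+ (fromℤ m) (fromℤ n))))

  fromℤ-* : ∀ m n → fromℤ (m ℤ.* n) ≡ fromℤ m * fromℤ n
  fromℤ-* m n = toℚᵘ-injective (ℚᵘ.≃-sym (toℚᵘ-homo-* (fromℤ m) (fromℤ n)))

  <⇒≱ : ∀ {p q} → p < q → q ≰ p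
  <⇒≱ p<q q≤p = <-irrefl refl (<-≤-trans p<q q≤p)

  fromℤ-mono-≤ : ∀ {m n} → m ℤ.≤ n → fromℤ m ≤ fromℤ n
  fromℤ-mono-≤ m≤n = *≤* (ℤ.*-monoʳ-≤-nonNeg (+ 1) m≤n)

  fromℤ-mono-< : ∀ {m n} → m ℤ.< n → fromℤ m < fromℤ n
  fromℤ-mono-< m<n = *<* (ℤ.*-monoʳ-<-pos (+ 1) m<n)

  convex : ℚ → ℚ → ℚ → ℚ
  convex t a b = (1ℚ - t) * a + t * b

  convex-const : ∀ t a → convex t a a ≡ a
  convex-const = solve 2 (λ t a → (con 1ℚ :- t) :* a :+ t :* a := a) refl

  convex-0 : ∀ a b → convex 0ℚ a b ≡ a
  convex-0 = solve 2 (λ a b → (con 1ℚ :- con 0ℚ) :* a :+ con 0ℚ :* b := a) refl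

  convex-1 : ∀ a b → convex 1ℚ a b ≡ b
  convex-1 = solve 2 (λ a b → (con 1ℚ :- con 1ℚ) :* a :+ con 1ℚ :* b := b) refl

  convex-swap : ∀ t a b → convex t a b ≡ convex (1ℚ - t) b a
  convex-swap = solve 3 (λ t a b → (con 1ℚ :- t) :* a :+ t :* b
                                := (con 1ℚ :- (con 1ℚ :- t)) :* b :+ (con 1ℚ :- t) :* a) refl

  between-0 : ∀ p q → between p q 0ℚ ≡ p
  between-0 (x₁ , y₁) (x₂ , y₂) = cong₂ _,_ (convex-0 x₁ x₂) (convex-0 y₁ y₂)

  between-1 : ∀ p q → between p q 1ℚ ≡ q
  between-1 (x₁ , y₁) (x₂ , y₂) = cong₂ _,_ (convex-1 x₁ x₂) (convex-1 y₁ y₂)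

  1-t≥0 : ∀ {t} → t ≤ 1ℚ → 0ℚ ≤ 1ℚ - t
  1-t≥0 {t} t≤1 = subst (_≤ 1ℚ - t) (+-inverseʳ t) (+-monoˡ-≤ (- t) t≤1)

  1-t>0 : ∀ {t} → t < 1ℚ → 0ℚ < 1ℚ - t
  1-t>0 {t} t<1 = subst (_< 1ℚ - t) (+-inverseʳ t) (+-monoˡ-< (- t) t<1)

  module _ {t a b c d : ℚ} (0≤t : 0ℚ ≤ t) (t≤1 : t ≤ 1ℚ) where

    convex-mono-≤ : a ≤ c → b ≤ d → convex t a b ≤ convex t c d
    convex-mono-≤ a≤c b≤d = +-mono-≤
      (*-monoˡ-≤-nonNeg (1ℚ - t) {{nonNegative (1-t≥0 t≤1)}} a≤c)
      (*-monoˡ-≤-nonNeg t {{nonNegative 0≤t}} b≤d)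

    convex-mono-<-≤ : t < 1ℚ → a < c → b ≤ d → convex t a b < convex t c d
    convex-mono-<-≤ t<1 a<c b≤d = +-mono-<-≤
      (*-monoʳ-<-pos (1ℚ - t) {{positive (1-t>0 t<1)}} a<c)
      (*-monoˡ-≤-nonNeg t {{nonNegative 0≤t}} b≤d)

    convex-mono-≤-< : 0ℚ < t → a ≤ c → b < d → convex t a b < convex t c d
    convex-mono-≤-< 0<t a≤c b<d = +-mono-≤-<
      (*-monoˡ-≤-nonNeg (1ℚ - t) {{nonNegative (1-t≥0 t≤1)}} a≤c)
      (*-monoʳ-<-pos t {{positive 0<t}} b<d)

    -- At least one of the weights `1ℚ - t` and `t` is positive, and the strict inequality at that
    -- end carries over.
    convex-mono-< : a < c → b < d → convex t a b < convex t c d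
    convex-mono-< a<c b<d with <-cmp t 1ℚ
    ... | tri< t<1 _ _  = convex-mono-<-≤ t<1 a<c (<⇒≤ b<d)
    ... | tri≈ _ refl _ = convex-mono-≤-< (positive⁻¹ 1ℚ) (<⇒≤ a<c) b<d
    ... | tri> _ _ 1<t  = contradiction t≤1 (<⇒≱ 1<t)

  Affine : Set
  Affine = ℚ × ℚ × ℚ

  ⟦_⟧ : Affine → Point → ℚ
  ⟦ α , β , γ ⟧ (x , y) = α * x + β * y + γ

  ⟦⟧-between : ∀ f p q t → ⟦ f ⟧ (between p q t) ≡ convex t (⟦ f ⟧ p) (⟦ f ⟧ q)
  ⟦⟧-between (α , β , γ) (x₁ , y₁) (x₂ , y₂) t =
    solve 8 (λ α β γ x₁ y₁ x₂ y₂ t →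
      α :* ((con 1ℚ :- t) :* x₁ :+ t :* x₂) :+ β :* ((con 1ℚ :- t) :* y₁ :+ t :* y₂) :+ γ
      := (con 1ℚ :- t) :* (α :* x₁ :+ β :* y₁ :+ γ) :+ t :* (α :* x₂ :+ β :* y₂ :+ γ))
      refl α β γ x₁ y₁ x₂ y₂ t

  Separated : (a b c d : ℚ) → Set
  Separated a b c d =
    (0ℚ ≤ a × 0ℚ ≤ b) × (c ≤ 0ℚ × d ≤ 0ℚ) × ((0ℚ < a ⊎ 0ℚ < b) ⊎ (c < 0ℚ × d < 0ℚ))

  ∈-swap : ∀ {p q x} → x ∈[ p , q ] → x ∈[ q , p ]
  ∈-swap {p} {q} (t , 0≤t , t≤1 , refl) =
    1ℚ - t , 1-t≥0 t≤1 , subst (1ℚ - t ≤_) (+-identityʳ 1ℚ) (+-monoʳ-≤ 1ℚ (neg-antimono-≤ 0≤t)) ,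
    cong₂ _,_ (convex-swap t _ _) (convex-swap t _ _)

  -- At a common point the value of `f` is both nonnegative and nonpositive, hence zero. If `f` is
  -- positive at one end of the first segment, that end has weight zero and the point is the other
  -- end; if `f` is negative at both ends of the second segment, there is no common point.
  separated-meet : ∀ f {p q r s x} →
    Separated (⟦ f ⟧ p) (⟦ f ⟧ q) (⟦ f ⟧ r) (⟦ f ⟧ s) →
    x ∈[ p , q ] → x ∈[ r , s ] → x ≡ p ⊎ x ≡ q
  separated-meet f {p} {q} {r} {s} {x} ((a≥0 , b≥0) , (c≤0 , d≤0) , strict) (t , 0≤t , t≤1 , x≡) (u , 0≤u , u≤1 , x≡′) =
    conclude strict
    where
    a = ⟦ f ⟧ p
    b = ⟦ f ⟧ q
    c = ⟦ f ⟧ r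
    d = ⟦ f ⟧ s

    value : convex t a b ≡ convex u c d
    value = trans (sym (⟦⟧-between f p q t)) (trans (cong ⟦ f ⟧ (trans (sym x≡) x≡′)) (⟦⟧-between f r s u))

    nonneg : 0ℚ ≤ convex t a b
    nonneg = subst (_≤ convex t a b) (convex-const t 0ℚ) (convex-mono-≤ 0≤t t≤1 a≥0 b≥0)

    nonpos : convex t a b ≤ 0ℚ
    nonpos = subst₂ _≤_ (sym value) (convex-const u 0ℚ) (convex-mono-≤ 0≤u u≤1 c≤0 d≤0)

    conclude : (0ℚ < a ⊎ 0ℚ < b) ⊎ (c < 0ℚ × d < 0ℚ) → x ≡ p ⊎ x ≡ q
    conclude (inj₁ (inj₁ a>0)) with <-cmp t 1ℚ
    ... | tri< t<1 _ _  = contradiction nonpos (<⇒≱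
      (subst (_< convex t a b) (convex-const t 0ℚ) (convex-mono-<-≤ 0≤t t≤1 t<1 a>0 b≥0)))
    ... | tri≈ _ refl _ = inj₂ (trans x≡ (between-1 p q))
    ... | tri> _ _ 1<t  = contradiction t≤1 (<⇒≱ 1<t)
    conclude (inj₁ (inj₂ b>0)) with <-cmp 0ℚ t
    ... | tri< 0<t _ _  = contradiction nonpos (<⇒≱
      (subst (_< convex t a b) (convex-const t 0ℚ) (convex-mono-≤-< 0≤t t≤1 0<t a≥0 b>0)))
    ... | tri≈ _ refl _ = inj₁ (trans x≡ (between-0 p q))
    ... | tri> _ _ t<0  = contradiction 0≤t (<⇒≱ t<0)
    conclude (inj₂ (c<0 , d<0)) = contradiction nonneg (<⇒≱
      (subst₂ _<_ (sym value) (convex-const u 0ℚ) (convex-mono-< 0≤u u≤1 c<0 d<0)))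

  scaled-mono-≤ : ∀ s .{{_ : Positive s}} {m n} → m ℤ.≤ n → s * fromℤ m ≤ s * fromℤ n
  scaled-mono-≤ s m≤n = *-monoˡ-≤-nonNeg s {{pos⇒nonNeg s}} (fromℤ-mono-≤ m≤n)

  scaled-mono-< : ∀ s .{{_ : Positive s}} {m n} → m ℤ.< n → s * fromℤ m < s * fromℤ n
  scaled-mono-< s m<n = *-monoʳ-<-pos s (fromℤ-mono-< m<n)

  module _ (s : ℚ) .{{_ : Positive s}} {n : ℤ} where

    scaled-≥0 : 0ℤ ℤ.≤ n → 0ℚ ≤ s * fromℤ n
    scaled-≥0 0≤n = subst (_≤ s * fromℤ n) (*-zeroʳ s) (scaled-mono-≤ s 0≤n)

    scaled->0 : 0ℤ ℤ.< n → 0ℚ < s * fromℤ n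
    scaled->0 0<n = subst (_< s * fromℤ n) (*-zeroʳ s) (scaled-mono-< s 0<n)

    scaled-≤0 : n ℤ.≤ 0ℤ → s * fromℤ n ≤ 0ℚ
    scaled-≤0 n≤0 = subst (s * fromℤ n ≤_) (*-zeroʳ s) (scaled-mono-≤ s n≤0)

    scaled-<0 : n ℤ.< 0ℤ → s * fromℤ n < 0ℚ
    scaled-<0 n<0 = subst (s * fromℤ n <_) (*-zeroʳ s) (scaled-mono-< s n<0)

  place : ℚ → GridPoint → Point
  place s (m , n) = fromℤ m , s * fromℤ n

  -- The line transported along (x , y) ↦ (x , s y), with its equation multiplied by s to avoid a
  -- division.
  stretch : ℚ → Affineℤ → Affine
  stretch s (α , β , γ) = s * fromℤ α , fromℤ β , s * fromℤ γ

  fromℤ-⟦⟧ : ∀ α β γ m n → fromℤ (⟦ α , β , γ ⟧ℤ (m , n)) ≡ fromℤ α * fromℤ m + fromℤ β * fromℤ n + fromℤ γ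
  fromℤ-⟦⟧ α β γ m n = begin
    fromℤ (α ℤ.* m ℤ.+ β ℤ.* n ℤ.+ γ)                     ≡⟨ fromℤ-+ (α ℤ.* m ℤ.+ β ℤ.* n) γ ⟩
    fromℤ (α ℤ.* m ℤ.+ β ℤ.* n) + fromℤ γ                 ≡⟨ cong (_+ fromℤ γ) (fromℤ-+ (α ℤ.* m) (β ℤ.* n)) ⟩
    fromℤ (α ℤ.* m) + fromℤ (β ℤ.* n) + fromℤ γ           ≡⟨ cong₂ (λ x y → x + y + fromℤ γ) (fromℤ-* α m) (fromℤ-* β n) ⟩
    fromℤ α * fromℤ m + fromℤ β * fromℤ n + fromℤ γ ∎
    where open ≡-Reasoning

  ⟦stretch⟧ : ∀ s f g → ⟦ stretch s f ⟧ (place s g) ≡ s * fromℤ (⟦ f ⟧ℤ g)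
  ⟦stretch⟧ s (α , β , γ) (m , n) = trans
    (solve 6 (λ s α β γ m n → s :* α :* m :+ β :* (s :* n) :+ s :* γ := s :* (α :* m :+ β :* n :+ γ)) refl
      s (fromℤ α) (fromℤ β) (fromℤ γ) (fromℤ m) (fromℤ n))
    (cong (s *_) (sym (fromℤ-⟦⟧ α β γ m n)))

  separated-cong : ∀ {a a′ b b′ c c′ d d′} → a ≡ a′ → b ≡ b′ → c ≡ c′ → d ≡ d′ →
    Separated a′ b′ c′ d′ → Separated a b c d
  separated-cong refl refl refl refl = id

  stretch-separated : ∀ s .{{_ : Positive s}} f g₁ g₂ g₃ g₄ →
    Separatedℤ (⟦ f ⟧ℤ g₁) (⟦ f ⟧ℤ g₂) (⟦ f ⟧ℤ g₃) (⟦ f ⟧ℤ g₄) →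
    Separated (⟦ stretch s f ⟧ (place s g₁)) (⟦ stretch s f ⟧ (place s g₂))
              (⟦ stretch s f ⟧ (place s g₃)) (⟦ stretch s f ⟧ (place s g₄))
  stretch-separated s f g₁ g₂ g₃ g₄ ((a , b) , (c , d) , strict) =
    separated-cong (⟦stretch⟧ s f g₁) (⟦stretch⟧ s f g₂) (⟦stretch⟧ s f g₃) (⟦stretch⟧ s f g₄)
      ((scaled-≥0 s a , scaled-≥0 s b) , (scaled-≤0 s c , scaled-≤0 s d) ,
       Sum.map (Sum.map (scaled->0 s) (scaled->0 s)) (Product.map (scaled-<0 s) (scaled-<0 s)) strict)

  -- Vanishes on the line of index σ of the tent of height 100 s.
  level : ℚ → Fin 2 → Affine
  level s σ = s * fromℤ (side σ) , 1ℚ , s * fromℤ (ℤ.- + 100)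

  ⟦level⟧ : ∀ r s σ g → ⟦ level s σ ⟧ (place r g) ≡ r * fromℤ (proj₂ g) + s * fromℤ (margin σ g)
  ⟦level⟧ r s σ (m , n) = trans
    (solve 6 (λ r s m n v c → s :* v :* m :+ con 1ℚ :* (r :* n) :+ s :* c := r :* n :+ s :* (v :* m :+ c)) refl
      r s (fromℤ m) (fromℤ n) (fromℤ (side σ)) (fromℤ (ℤ.- + 100)))
    (cong (λ z → r * fromℤ n + s * z) (sym (trans (fromℤ-+ (side σ ℤ.* m) (ℤ.- + 100))
      (cong (_+ fromℤ (ℤ.- + 100)) (fromℤ-* (side σ) m)))))

  upper-level : ∀ s σ a → ⟦ level s σ ⟧ (place s (grid a)) ≡ s * fromℤ (overFloor σ a)
  upper-level s σ a = begin
    ⟦ level s σ ⟧ (place s (grid a))  ≡⟨ ⟦level⟧ s s σ (grid a) ⟩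
    s * fromℤ n + s * fromℤ d         ≡⟨ *-distribˡ-+ s (fromℤ n) (fromℤ d) ⟨
    s * (fromℤ n + fromℤ d)           ≡⟨ cong (s *_) (fromℤ-+ n d) ⟨
    s * fromℤ (overFloor σ a) ∎
    where
    open ≡-Reasoning
    n = proj₂ (grid a)
    d = margin σ (grid a)

  -- Lowering the tent from height 100 s to 200 r does not decrease the value, and at 200 r the tent
  -- is the ceiling of the copy scaled by r.
  lower-level : ∀ {r s} → r + r ≤ s → ∀ σ a → ⟦ level s σ ⟧ (place r (grid a)) ≤ r * fromℤ (overCeiling σ a)
  lower-level {r} {s} 2r≤s σ a = begin
    ⟦ level s σ ⟧ (place r (grid a))       ≡⟨ ⟦level⟧ r s σ (grid a) ⟩
    r * fromℤ n + s * fromℤ d              ≤⟨ +-monoʳ-≤ (r * fromℤ n)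
      (*-monoʳ-≤-nonPos (fromℤ d) {{nonPositive (fromℤ-mono-≤ (between-hubs a σ))}} 2r≤s) ⟩
    r * fromℤ n + (r + r) * fromℤ d        ≡⟨ solve 3 (λ r n d →
      r :* n :+ (r :+ r) :* d := r :* (n :+ (d :+ d))) refl r (fromℤ n) (fromℤ d) ⟩
    r * (fromℤ n + (fromℤ d + fromℤ d))    ≡⟨ cong (λ z → r * (fromℤ n + z)) (fromℤ-+ d d) ⟨
    r * (fromℤ n + fromℤ (d ℤ.+ d))        ≡⟨ cong (r *_) (fromℤ-+ n (d ℤ.+ d)) ⟨
    r * fromℤ (overCeiling σ a) ∎
    where
    open ≤-Reasoning
    n = proj₂ (grid a)
    d = margin σ (grid a)

  scale : ℕ → ℚ
  scale zero    = 1ℚ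
  scale (suc k) = scale k + scale k

  scale-positive : ∀ k → Positive (scale k)
  scale-positive zero    = _
  scale-positive (suc k) = pos+pos⇒pos (scale k) {{scale-positive k}} (scale k) {{scale-positive k}}

  -- The ceiling of a copy is no higher than the floor of any later copy.
  scale-double : ∀ {j k} → j ℕ.< k → scale j + scale j ≤ scale k
  scale-double {j} j<k = go (ℕ.≤⇒≤′ j<k)
    where
    go : ∀ {k} → ℕ.suc j ℕ.≤′ k → scale j + scale j ≤ scale k
    go ℕ.≤′-refl = ≤-refl
    go (ℕ.≤′-step {k} j<k) = ≤-trans (go j<k)
      (subst (_≤ scale k + scale k) (+-identityʳ (scale k))
        (+-monoʳ-≤ (scale k) (<⇒≤ (positive⁻¹ (scale k) {{scale-positive k}}))))

  module _ {p : ℚ} where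

    neg-≤0 : p ≤ 0ℚ → 0ℚ ≤ - p
    neg-≤0 = neg-antimono-≤ {p} {0ℚ}

    neg-≥0 : 0ℚ ≤ p → - p ≤ 0ℚ
    neg-≥0 = neg-antimono-≤ {0ℚ} {p}

    neg-<0 : p < 0ℚ → 0ℚ < - p
    neg-<0 = neg-antimono-< {p} {0ℚ}

  start∈ : ∀ p q → p ∈[ p , q ]
  start∈ p q = 0ℚ , ≤-refl , <⇒≤ (positive⁻¹ 1ℚ) , sym (between-0 p q)

  negate : Affine → Affine
  negate (α , β , γ) = - α , - β , - γ

  ⟦negate⟧ : ∀ f p → ⟦ negate f ⟧ p ≡ - ⟦ f ⟧ p
  ⟦negate⟧ (α , β , γ) (x , y) = solve 5 (λ α β γ x y →
    (:- α) :* x :+ (:- β) :* y :+ (:- γ) := :- (α :* x :+ β :* y :+ γ)) refl α β γ x y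

  spot : ℕ → Site → Point
  spot k a = place (scale k) (grid a)

  -- Naming an end of the first edge is enough: a drawing only asks that the common point be a
  -- vertex.
  Meet : ℕ → Edge → ℕ → Edge → Set
  Meet j (a , b) k (c , d) = ∀ {x} → x ∈[ spot j a , spot j b ] → x ∈[ spot k c , spot k d ] →
    x ≡ spot j a ⊎ x ≡ spot j b

  module _ {j k : ℕ} (j<k : j ℕ.< k) (σ : Fin 2) (a : Site) where

    lower-≤ : overCeiling σ a ℤ.≤ 0ℤ → ⟦ level (scale k) σ ⟧ (spot j a) ≤ 0ℚ
    lower-≤ i≤0 = ≤-trans (lower-level {scale j} {scale k} (scale-double j<k) σ a)
      (scaled-≤0 (scale j) {{scale-positive j}} i≤0)

    lower-< : overCeiling σ a ℤ.< 0ℤ → ⟦ level (scale k) σ ⟧ (spot j a) < 0ℚ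
    lower-< i<0 = ≤-<-trans (lower-level {scale j} {scale k} (scale-double j<k) σ a)
      (scaled-<0 (scale j) {{scale-positive j}} i<0)

  module _ (k : ℕ) (σ : Fin 2) (a : Site) where

    upper-≥ : 0ℤ ℤ.≤ overFloor σ a → 0ℚ ≤ ⟦ level (scale k) σ ⟧ (spot k a)
    upper-≥ 0≤o = subst (0ℚ ≤_) (sym (upper-level (scale k) σ a)) (scaled-≥0 (scale k) {{scale-positive k}} 0≤o)

    upper-> : 0ℤ ℤ.< overFloor σ a → 0ℚ < ⟦ level (scale k) σ ⟧ (spot k a)
    upper-> 0<o = subst (0ℚ <_) (sym (upper-level (scale k) σ a)) (scaled->0 (scale k) {{scale-positive k}} 0<o)

  -- The upper edge is above one line of its floor, and the lower edge is below both, so that line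
  -- separates them. It is negated because `Separated` wants the first edge on the nonnegative side.
  meet-below : ∀ {j k} e e′ → (∀ σ → Below σ e) → ∃ (λ σ → Above σ e′) → j ℕ.< k → Meet j e k e′
  meet-below {j} {k} (a , b) (c , d) below (σ , (0≤c , 0≤d) , _) j<k =
    let (a≤0 , b≤0) , strict = below σ
        f = level (scale k) σ
    in separated-meet (negate f) {spot j a} {spot j b} {spot k c} {spot k d} (separated-cong
      (⟦negate⟧ f (spot j a)) (⟦negate⟧ f (spot j b)) (⟦negate⟧ f (spot k c)) (⟦negate⟧ f (spot k d))
      ((neg-≤0 (lower-≤ j<k σ a a≤0) , neg-≤0 (lower-≤ j<k σ b b≤0)) ,
       (neg-≥0 (upper-≥ k σ c 0≤c) , neg-≥0 (upper-≥ k σ d 0≤d)) ,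
       inj₁ (Sum.map (neg-<0 ∘ lower-< j<k σ a) (neg-<0 ∘ lower-< j<k σ b) strict)))

  meet-above : ∀ {j k} e e′ → ∃ (λ σ → Above σ e) → (∀ σ → Below σ e′) → k ℕ.< j → Meet j e k e′
  meet-above {j} {k} (a , b) (c , d) (σ , (0≤a , 0≤b) , strict) below k<j =
    let (c≤0 , d≤0) , _ = below σ
    in separated-meet (level (scale j) σ) {spot j a} {spot j b} {spot k c} {spot k d}
      ((upper-≥ j σ a 0≤a , upper-≥ j σ b 0≤b) , (lower-≤ k<j σ c c≤0 , lower-≤ k<j σ d d≤0) ,
       inj₁ (Sum.map (upper-> j σ a) (upper-> j σ b) strict))

  meet-same : ∀ k e e′ → Any (Splits e e′) (lines e e′) → Meet k e k e′
  meet-same k (a , b) (c , d) splits =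
    let f , _ , separated = find splits
    in separated-meet (stretch (scale k) f) {spot k a} {spot k b} {spot k c} {spot k d}
      (stretch-separated (scale k) {{scale-positive k}} f (grid a) (grid b) (grid c) (grid d) separated)

  meet : ∀ j k e e′ → e ∈ edges → e′ ∈ edges → (j ≡ k × e ≡ e′) ⊎ Meet j e k e′
  meet j k e e′ e∈ e′∈ with ℕ.<-cmp j k
  ... | tri< j<k _ _  = inj₂ (meet-below e e′ (All.lookup edges-below e∈) (All.lookup edges-above e′∈) j<k)
  ... | tri≈ _ refl _ = Sum.map (refl ,_) (meet-same j e e′) (All.lookup (All.lookup edges-split e∈) e′∈)
  ... | tri> _ _ k<j  = inj₂ (meet-above e e′ (All.lookup edges-above e∈) (All.lookup edges-below e′∈) k<j)

  fromℤ-injective : ∀ {m n} → fromℤ m ≡ fromℤ n → m ≡ n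
  fromℤ-injective = cong ℚ.numerator

  spot-injective : ∀ k a b → spot k a ≡ spot k b → a ≡ b
  spot-injective k a b eq = grid-injective a b (cong₂ _,_
    (fromℤ-injective (,-injectiveˡ eq))
    (fromℤ-injective (cancel (,-injectiveʳ eq))))
    where
    cancel : ∀ {x y} → scale k * x ≡ scale k * y → x ≡ y
    cancel eq = ≤-antisym
      (*-cancelˡ-≤-pos (scale k) {{scale-positive k}} (≤-reflexive eq))
      (*-cancelˡ-≤-pos (scale k) {{scale-positive k}} (≤-reflexive (sym eq)))

  spot-ascending : ∀ {j k} a b → j ℕ.< k → spot j (inj₂ a) ≢ spot k (inj₂ b)
  spot-ascending {j} {k} a b j<k eq = <-irrefl (cong ⟦ level (scale k) 0F ⟧ eq)
    (<-trans (lower-< j<k 0F (inj₂ a) (inner-below a)) (upper-> k 0F (inj₂ b) (inner-above b)))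

  sameEnds-sym : ∀ {V : Set} {u v x y : V} → SameEnds u v x y → SameEnds v u x y
  sameEnds-sym (inj₁ (p , q)) = inj₂ (q , p)
  sameEnds-sym (inj₂ (p , q)) = inj₁ (q , p)

  sameEnds-join : ∀ {V : Set} {u v x y a b : V} → SameEnds u v a b → SameEnds x y a b → SameEnds u v x y
  sameEnds-join (inj₁ (refl , refl)) (inj₁ (refl , refl)) = inj₁ (refl , refl)
  sameEnds-join (inj₁ (refl , refl)) (inj₂ (refl , refl)) = inj₂ (refl , refl)
  sameEnds-join (inj₂ (refl , refl)) (inj₁ (refl , refl)) = inj₂ (refl , refl)
  sameEnds-join (inj₂ (refl , refl)) (inj₂ (refl , refl)) = inj₁ (refl , refl)

  -- The graph formed by N copies on common hubs, and its drawing.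

  module Copies (N : ℕ) where

    Vertex : Set
    Vertex = Fin 2 ⊎ (Fin N × Fin 14)

    at : Fin N → Site → Vertex
    at i (inj₁ h) = inj₁ h
    at i (inj₂ k) = inj₂ (i , k)

    _≟ᵛ_ : DecidableEquality Vertex
    _≟ᵛ_ = ⊎-≡-dec Fin._≟_ (×-≡-dec Fin._≟_ Fin._≟_)

    Adj : Vertex → Vertex → Set
    Adj x y = ∃ λ i → Any (λ (a , b) → SameEnds x y (at i a) (at i b)) edges

    at-injective : ∀ i {a b} → at i a ≡ at i b → a ≡ b
    at-injective i {inj₁ _} {inj₁ _} refl = refl
    at-injective i {inj₂ _} {inj₂ _} refl = refl

    graph : Graph
    graph = record
      { Vertex     = Vertex
      ; order      = 2 ℕ.+ N ℕ.* 14
      ; enumerate  = ↔-sym ((↔-id _ ⊎-↔ Fin.*↔×) ↔-∘ Fin.+↔⊎)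
      ; Adj        = Adj
      ; adj?       = λ x y → Fin.any? λ i → Any.any? (λ (a , b) →
          ((x ≟ᵛ at i a) ×-dec (y ≟ᵛ at i b)) ⊎-dec ((x ≟ᵛ at i b) ×-dec (y ≟ᵛ at i a))) edges
      ; adj-sym    = Product.map₂ (Any.map sameEnds-sym)
      ; adj-irrefl = irrefl
      }
      where
      irrefl : ∀ {x y} → x ≡ y → Adj x y → _
      irrefl refl (i , e) with find e
      ... | _ , e∈ , inj₁ (p , q) = All.lookup edges-proper e∈ (at-injective i (trans (sym p) q))
      ... | _ , e∈ , inj₂ (p , q) = All.lookup edges-proper e∈ (at-injective i (trans (sym q) p))

    position : Vertex → Point
    position (inj₁ h)       = spot 0 (inj₁ h)
    position (inj₂ (i , k)) = spot (toℕ i) (inj₂ k)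

    -- The hubs lie on the x-axis, so every scaling fixes them.
    position-at : ∀ i a → position (at i a) ≡ spot (toℕ i) a
    position-at i (inj₁ 0F) = cong (fromℤ _ ,_) (sym (*-zeroʳ (scale (toℕ i))))
    position-at i (inj₁ 1F) = cong (fromℤ _ ,_) (sym (*-zeroʳ (scale (toℕ i))))
    position-at i (inj₂ k)  = refl

    position-at-injective : ∀ i a b → position (at i a) ≡ position (at i b) → at i a ≡ at i b
    position-at-injective i a b eq = cong (at i)
      (spot-injective (toℕ i) a b (trans (sym (position-at i a)) (trans eq (position-at i b))))

    position-injective : Injective _≡_ _≡_ position
    position-injective {inj₁ h}       {inj₁ h′}      eq = hub-cong (spot-injective 0 (inj₁ h) (inj₁ h′) eq)
      where
      hub-cong : ∀ {h h′} → inj₁ h ≡ inj₁ h′ → _≡_ {A = Vertex} (inj₁ h) (inj₁ h′)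
      hub-cong refl = refl
    position-injective {inj₁ h}       {inj₂ (i , k)} eq = position-at-injective i (inj₁ h) (inj₂ k) eq
    position-injective {inj₂ (i , k)} {inj₁ h}       eq = position-at-injective i (inj₂ k) (inj₁ h) eq
    position-injective {inj₂ (i , k)} {inj₂ (j , l)} eq with Fin.<-cmp i j
    ... | tri< i<j _ _  = contradiction eq (spot-ascending k l i<j)
    ... | tri≈ _ refl _ = position-at-injective i (inj₂ k) (inj₂ l) eq
    ... | tri> _ _ j<i  = contradiction (sym eq) (spot-ascending l k j<i)

    module _ {x y : Vertex} (i : Fin N) (a b : Site) (ends : SameEnds x y (at i a) (at i b)) {p : Point} where

      to-spots : p ∈[ position x , position y ] → p ∈[ spot (toℕ i) a , spot (toℕ i) b ]
      to-spots p∈ = subst₂ (p ∈[_,_]) (position-at i a) (position-at i b) (orient ends p∈)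
        where
        orient : SameEnds x y (at i a) (at i b) → p ∈[ position x , position y ] →
                 p ∈[ position (at i a) , position (at i b) ]
        orient (inj₁ (refl , refl)) = id
        orient (inj₂ (refl , refl)) = ∈-swap

      from-spots : p ≡ spot (toℕ i) a ⊎ p ≡ spot (toℕ i) b → p ≡ position x ⊎ p ≡ position y
      from-spots p≡ = orient ends (Sum.map
        (λ eq → trans eq (sym (position-at i a)))
        (λ eq → trans eq (sym (position-at i b))) p≡)
        where
        orient : SameEnds x y (at i a) (at i b) → p ≡ position (at i a) ⊎ p ≡ position (at i b) →
                 p ≡ position x ⊎ p ≡ position y
        orient (inj₁ (refl , refl)) = id
        orient (inj₂ (refl , refl)) = Sum.swap

    -- Translates `meet` from sites to vertices. Both the crossing condition and, through
    -- `neighbour`, the condition on vertices lying on edges follow from it.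
    lines-cross : ∀ {u v x y} → Adj u v → Adj x y → ∀ {p} → p ∈[ position u , position v ] → p ∈[ position x , position y ] →
      SameEnds u v x y ⊎ (p ≡ position u ⊎ p ≡ position v)
    lines-cross {u} {v} {x} {y} (i , e) (j , f) {p} p∈e p∈f =
      Sum.map same
        (λ meets → from-spots i a b ends (meets (to-spots i a b ends p∈e) (to-spots j c d ends′ p∈f)))
        (meet (toℕ i) (toℕ j) (a , b) (c , d) e∈ f∈)
      where
      a     = proj₁ (proj₁ (find e))
      b     = proj₂ (proj₁ (find e))
      e∈    = proj₁ (proj₂ (find e))
      ends  = proj₂ (proj₂ (find e))
      c     = proj₁ (proj₁ (find f))
      d     = proj₂ (proj₁ (find f))
      f∈    = proj₁ (proj₂ (find f))
      ends′ = proj₂ (proj₂ (find f))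
      same : toℕ i ≡ toℕ j × (a , b) ≡ (c , d) → SameEnds u v x y
      same (i≡j , e≡f) = sameEnds-join ends
        (subst₂ (λ k (a , b) → SameEnds x y (at k a) (at k b)) (sym (Fin.toℕ-injective i≡j)) (sym e≡f) ends′)

    neighbour : ∀ {u v} → Adj u v → ∀ w → ∃ λ w′ → Adj w w′
    neighbour {u} {v} e (inj₂ (i , k)) with edge-at k
    ... | inj₁ h∈ = inj₁ 0F , i , lose h∈ (inj₂ (refl , refl))
    ... | inj₂ h∈ = inj₁ 1F , i , lose h∈ (inj₂ (refl , refl))
    -- A hub belongs to no particular copy; the given edge supplies an index, which shows that there
    -- is a copy at all.
    neighbour {u} {v} (i , _) (inj₁ h) with hub-edge h
    ... | k , h∈ = inj₂ (i , k) , i , lose h∈ (inj₁ (refl , refl))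

    drawing : PlaneDrawing graph
    drawing = record
      { pos            = position
      ; pos-injective  = position-injective
      ; line           = λ {u} {v} _ → segment (position u) (position v)
      ; line-arc       = λ e eq → Graph.adj-irrefl graph (position-injective eq) e
      ; line-sym       = λ _ _ → ∈-swap
      ; vertex-on-line = on-line
      ; lines-meet     = λ e f p∈e p∈f → Sum.map₂ [ (_ ,_) , (_ ,_) ]′ (lines-cross e f p∈e p∈f)
      }
      where
      on-line : ∀ {u v} → Adj u v → ∀ w → position w ∈[ position u , position v ] → w ≡ u ⊎ w ≡ v
      on-line {u} {v} e w w∈ =
        -- The vertex is the start of an edge of its own. Either that edge is the given one, or the
        -- two meet in an end of the given edge.
        let w′ , f = neighbour e w
        in [ end , Sum.map position-injective position-injective ]′
             (lines-cross e f w∈ (start∈ (position w) (position w′)))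
        where
        end : ∀ {w′} → SameEnds u v w w′ → w ≡ u ⊎ w ≡ v
        end (inj₁ (refl , _)) = inj₁ refl
        end (inj₂ (_ , refl)) = inj₂ refl

-- The list assignment on the copies, and the double count in the copy that fits a coloring.

module Coloring where

  open import Data.Bool.Base using (Bool; true; false; if_then_else_)
  open import Data.Fin.Base using (Fin; _↑ˡ_; _↑ʳ_; funToFin; finToFun)
  open import Data.Fin.Patterns
  import Data.Fin.Properties as Fin
  open import Data.Fin.Subset using (Subset; _∈_; ∣_∣; ⊥; inside; outside)
  open import Data.Fin.Subset.Properties using (∣⊥∣≡0; x∈p∩q⁺)
  open import Data.List.Base using (length)
  import Data.List.Membership.Propositional as List
  open import Data.List.Relation.Unary.All as All using (All)
  open import Data.List.Relation.Unary.Any using (Any)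
  open import Data.Nat.Base
  open import Data.Nat.Properties
  open import Data.Product.Base using (_×_; _,_; proj₁; proj₂)
  open import Data.Sum.Base using (_⊎_; inj₁; inj₂)
  open import Data.Vec.Base using (lookup; replicate; tabulate; _++_)
  open import Data.Vec.Properties
    using (lookup-++ˡ; lookup-++ʳ; []=⇒lookup; lookup⇒[]=; lookup∘tabulate; lookup-replicate; tabulate∘lookup; tabulate-cong)
  open import Function.Base using (_∘_)
  open import Function.Bundles using (Inverse)
  open import Relation.Binary.PropositionalEquality
  open import Relation.Nullary.Decidable using (Dec; yes; no; does)
  open import Relation.Nullary.Negation.Core using (contradiction)
  open Counting
  open Gadget
  open Planarity using (module Copies)

  -- Numbers all m-tuples of subsets by their bits, so that the index of a copy is itself the guess
  -- of the two hub sets.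
  decode : ∀ {m n} → Fin ((2 ^ n) ^ m) → Fin m → Subset n
  decode {m} {n} i h = tabulate (λ c → Inverse.to Fin.2↔Bool (finToFun {2} {n} (finToFun {2 ^ n} {m} i h) c))

  encode : ∀ {m n} → (Fin m → Subset n) → Fin ((2 ^ n) ^ m)
  encode X = funToFin (λ h → funToFin (λ c → Inverse.from Fin.2↔Bool (lookup (X h) c)))

  decode∘encode : ∀ {m n} (X : Fin m → Subset n) h → decode (encode X) h ≡ X h
  decode∘encode {m} {n} X h = trans (tabulate-cong eq) (tabulate∘lookup (X h))
    where
    eq : ∀ c → Inverse.to Fin.2↔Bool (finToFun {2} {n} (finToFun {2 ^ n} {m} (encode X) h) c) ≡ lookup (X h) c
    eq c = begin
      Inverse.to Fin.2↔Bool (finToFun {2} {n} (finToFun {2 ^ n} {m} (encode X) h) c)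
        ≡⟨ cong (λ z → Inverse.to Fin.2↔Bool (finToFun {2} {n} z c)) (Fin.finToFun-funToFin {m} {2 ^ n} _ h) ⟩
      Inverse.to Fin.2↔Bool (finToFun {2} {n} (funToFin (λ c → Inverse.from Fin.2↔Bool (lookup (X h) c))) c)
        ≡⟨ cong (Inverse.to Fin.2↔Bool) (Fin.finToFun-funToFin {n} {2} _ c) ⟩
      Inverse.to Fin.2↔Bool (Inverse.from Fin.2↔Bool (lookup (X h) c))
        ≡⟨ Inverse.strictlyInverseˡ Fin.2↔Bool (lookup (X h) c) ⟩
      lookup (X h) c ∎
      where open ≡-Reasoning

  mask : ∀ {n} → Bool → Subset n → Subset n
  mask b p = if b then p else ⊥

  ∣mask∣ : ∀ {n} b (p : Subset n) → ∣ mask b p ∣ ≡ bit b * ∣ p ∣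
  ∣mask∣ inside  p = sym (*-identityˡ ∣ p ∣)
  ∣mask∣ {n} outside p = ∣⊥∣≡0 n

  lookup-mask : ∀ {n} b (p : Subset n) c → lookup (mask b p) c ≡ true → b ≡ true × lookup p c ≡ true
  lookup-mask true  p c eq = refl , eq
  lookup-mask {n} false p c eq with () ← trans (sym eq) (lookup-replicate c false)

  module _ (b e : ℕ) where

    a : ℕ
    a = 4 * b + e

    fresh : Fin 7 → ℕ
    fresh t = β t * b + ε t * e

    hubColors freshColors : ℕ
    hubColors   = sum {2} (λ _ → a)
    freshColors = sum fresh

    -- First one block of `a` colors for each hub, then the seven fresh classes.
    Colors : ℕ
    Colors = hubColors + freshColors

    hubColor : Fin 2 → Fin a → Fin Colors
    hubColor h c = color (λ _ → a) h c ↑ˡ freshColors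

    freshColor : ∀ t → Fin (fresh t) → Fin Colors
    freshColor t c = hubColors ↑ʳ color fresh t c

    palette : (Fin 2 → Subset a) → (∀ t → Subset (fresh t)) → Subset Colors
    palette f g = paint (λ _ → a) f ++ paint fresh g

    lookup-hubColor : ∀ f g h c → lookup (palette f g) (hubColor h c) ≡ lookup (f h) c
    lookup-hubColor f g h c = trans (lookup-++ˡ (paint (λ _ → a) f) _ _) (lookup-paint (λ _ → a) f h c)

    lookup-freshColor : ∀ f g t c → lookup (palette f g) (freshColor t c) ≡ lookup (g t) c
    lookup-freshColor f g t c = trans (lookup-++ʳ (paint (λ _ → a) f) _ _) (lookup-paint fresh g t c)

    ∣palette∣ : ∀ f g → ∣ palette f g ∣ ≡ sum (λ h → ∣ f h ∣) + sum (λ t → ∣ g t ∣)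
    ∣palette∣ f g = trans (∣++∣ (paint (λ _ → a) f) _) (cong₂ _+_ (∣paint∣ (λ _ → a) f) (∣paint∣ fresh g))

    ∣∣-by-color : ∀ (p : Subset Colors) → ∣ p ∣ ≡
      sum (λ h → sum (λ c → bit (lookup p (hubColor h c)))) +
      sum (λ t → sum (λ c → bit (lookup p (freshColor t c))))
    ∣∣-by-color p = trans (∣∣≡sum p) (trans (sum-++ hubColors member)
      (cong₂ _+_ (sum-colors {2} (λ _ → a) (λ (c : Fin hubColors) → member (c ↑ˡ freshColors)))
                 (sum-colors fresh (λ (c : Fin freshColors) → member (hubColors ↑ʳ c)))))
      where
      member : Fin Colors → ℕ
      member c = bit (lookup p c)

    open Copies ((2 ^ a) ^ 2)

    hubList : Fin 2 → Subset Colors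
    hubList h = palette (λ h′ → replicate a (does (h Fin.≟ h′))) (λ t → replicate (fresh t) false)

    innerList : (Fin 2 → Subset a) → Fin 14 → Subset Colors
    innerList X k = palette (λ h → mask (near h k) (X h)) (λ t → replicate (fresh t) (covers t k))

    hubList-hub : ∀ h h′ c → lookup (hubList h) (hubColor h′ c) ≡ does (h Fin.≟ h′)
    hubList-hub h h′ c = trans
      (lookup-hubColor (λ h′ → replicate a (does (h Fin.≟ h′))) (λ t → replicate (fresh t) false) h′ c)
      (lookup-replicate c (does (h Fin.≟ h′)))

    hubList-fresh : ∀ h t c → lookup (hubList h) (freshColor t c) ≡ false
    hubList-fresh h t c = trans
      (lookup-freshColor (λ h′ → replicate a (does (h Fin.≟ h′))) (λ t → replicate (fresh t) false) t c)
      (lookup-replicate c false)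

    innerList-hub : ∀ X k h c → lookup (innerList X k) (hubColor h c) ≡ lookup (mask (near h k) (X h)) c
    innerList-hub X k = lookup-hubColor (λ h → mask (near h k) (X h)) (λ t → replicate (fresh t) (covers t k))

    innerList-fresh : ∀ X k t c → lookup (innerList X k) (freshColor t c) ≡ covers t k
    innerList-fresh X k t c = trans
      (lookup-freshColor (λ h → mask (near h k) (X h)) (λ t → replicate (fresh t) (covers t k)) t c)
      (lookup-replicate c (covers t k))

    -- A guess with a wrong size never matches a coloring, so its copy gets a filler list of the
    -- right length. The decision is an argument so that proofs can split on it.
    copyList : ∀ {X : Fin 2 → Subset a} → Dec (∀ h → ∣ X h ∣ ≡ b) → Fin 14 → Subset Colors
    copyList {X} (yes _) k = innerList X k
    copyList     (no  _) k = hubList 0F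

    ∣hubList∣ : ∀ h → ∣ hubList h ∣ ≡ a
    ∣hubList∣ h = begin
      ∣ hubList h ∣
        ≡⟨ ∣palette∣ (λ h′ → replicate a (does (h Fin.≟ h′))) (λ t → replicate (fresh t) false) ⟩
      sum (λ h′ → ∣ replicate a (does (h Fin.≟ h′)) ∣) + sum (λ t → ∣ replicate (fresh t) false ∣)
        ≡⟨ cong₂ _+_ (sum-cong-≗ λ h′ → ∣replicate∣ a (does (h Fin.≟ h′))) (sum-zero λ t → ∣replicate∣ (fresh t) false) ⟩
      sum (λ h′ → bit (does (h Fin.≟ h′)) * a) + 0  ≡⟨ +-identityʳ _ ⟩
      sum (λ h′ → bit (does (h Fin.≟ h′)) * a)  ≡⟨ *-distribʳ-sum a (λ h′ → bit (does (h Fin.≟ h′))) ⟨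
      sum (λ h′ → bit (does (h Fin.≟ h′))) * a  ≡⟨ cong (_* a) (once h) ⟩
      1 * a  ≡⟨ *-identityˡ a ⟩
      a ∎
      where
      open ≡-Reasoning
      once : ∀ h → sum (λ h′ → bit (does (h Fin.≟ h′))) ≡ 1
      once 0F = refl
      once 1F = refl

    ∣innerList∣ : ∀ {X} → (∀ h → ∣ X h ∣ ≡ b) → ∀ k → ∣ innerList X k ∣ ≡ a
    ∣innerList∣ {X} ∣X∣≡b k = begin
      ∣ innerList X k ∣
        ≡⟨ ∣palette∣ (λ h → mask (near h k) (X h)) (λ t → replicate (fresh t) (covers t k)) ⟩
      sum (λ h → ∣ mask (near h k) (X h) ∣) + sum (λ t → ∣ replicate (fresh t) (covers t k) ∣)
        ≡⟨ cong₂ _+_ (sum-cong-≗ λ h → trans (∣mask∣ (near h k) (X h)) (cong (bit (near h k) *_) (∣X∣≡b h)))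
                     (sum-cong-≗ λ t → trans (∣replicate∣ (fresh t) (covers t k)) (expand (bit (covers t k)) (β t) (ε t))) ⟩
      sum (λ h → bit (near h k) * b) + sum (λ t → (bit (covers t k) * β t) * b + (bit (covers t k) * ε t) * e)
        ≡⟨ cong₂ _+_ (sym (*-distribʳ-sum b (λ h → bit (near h k))))
                       (sum-linear (λ t → bit (covers t k) * β t) (λ t → bit (covers t k) * ε t) b e) ⟩
      N * b + (B * b + E * e)  ≡⟨ +-assoc (N * b) _ _ ⟨
      N * b + B * b + E * e  ≡⟨ cong₂ _+_ (sym (*-distribʳ-+ b N B)) (cong (_* e) (row-ε k)) ⟩
      (N + B) * b + 1 * e  ≡⟨ cong₂ (λ x y → x * b + y) (row-β k) (*-identityˡ e) ⟩
      a ∎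
      where
      open ≡-Reasoning
      N = sum (λ h → bit (near h k))
      B = sum (λ t → bit (covers t k) * β t)
      E = sum (λ t → bit (covers t k) * ε t)
      expand : ∀ x y z → x * (y * b + z * e) ≡ x * y * b + x * z * e
      expand x y z = trans (*-distribˡ-+ x (y * b) (z * e)) (sym (cong₂ _+_ (*-assoc x y b) (*-assoc x z e)))

    valid? : ∀ (X : Fin 2 → Subset a) → Dec (∀ h → ∣ X h ∣ ≡ b)
    valid? X = Fin.all? λ h → ∣ X h ∣ ≟ b

    lists : ListAssignment graph Colors
    lists (inj₁ h)       = hubList h
    lists (inj₂ (i , k)) = copyList {decode i} (valid? (decode i)) k

    ∣copyList∣ : ∀ {X} (d : Dec (∀ h → ∣ X h ∣ ≡ b)) k → ∣ copyList {X} d k ∣ ≡ a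
    ∣copyList∣ {X} (yes valid) k = ∣innerList∣ {X} valid k
    ∣copyList∣ (no _)      k = ∣hubList∣ 0F

    ∣lists∣ : ∀ x → ∣ lists x ∣ ≡ a
    ∣lists∣ (inj₁ h)       = ∣hubList∣ h
    ∣lists∣ (inj₂ (i , k)) = ∣copyList∣ {decode i} (valid? (decode i)) k

    module _ (Φ : FoldColoring graph lists b) where

      open FoldColoring Φ

      hubSet : Fin 2 → Subset a
      hubSet h = tabulate (λ c → lookup (φ (inj₁ h)) (hubColor h c))

      used⇒listed : ∀ x c → lookup (φ x) c ≡ true → lookup (lists x) c ≡ true
      used⇒listed x c used = []=⇒lookup (φ⊆L x (lookup⇒[]= c (φ x) used))

      -- The list of a hub is its own block, so restricting its color set to that block loses
      -- nothing.
      ∣hubSet∣ : ∀ h → ∣ hubSet h ∣ ≡ b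
      ∣hubSet∣ h = begin
        ∣ hubSet h ∣  ≡⟨ ∣∣≡sum (hubSet h) ⟩
        sum (λ c → bit (lookup (hubSet h) c))
          ≡⟨ sum-cong-≗ (λ c → cong bit (lookup∘tabulate (λ c → lookup (φ (inj₁ h)) (hubColor h c)) c)) ⟩
        sum (λ c → bit (lookup (φ (inj₁ h)) (hubColor h c)))
          ≡⟨ sum-single h (λ h′ h′≢h → sum-zero λ c → bit≡0 (foreign h′ h′≢h c)) ⟨
        sum (λ h′ → sum (λ c → bit (lookup (φ (inj₁ h)) (hubColor h′ c))))
          ≡⟨ +-identityʳ _ ⟨
        sum (λ h′ → sum (λ c → bit (lookup (φ (inj₁ h)) (hubColor h′ c)))) + 0
          ≡⟨ cong (sum (λ h′ → sum (λ c → bit (lookup (φ (inj₁ h)) (hubColor h′ c)))) +_)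
               (sum-zero λ t → sum-zero λ c → bit≡0 (unfresh t c)) ⟨
        _  ≡⟨ ∣∣-by-color (φ (inj₁ h)) ⟨
        ∣ φ (inj₁ h) ∣  ≡⟨ size (inj₁ h) ⟩
        b ∎
        where
        open ≡-Reasoning
        foreign : ∀ h′ → h′ ≢ h → ∀ c → lookup (φ (inj₁ h)) (hubColor h′ c) ≢ true
        foreign h′ h′≢h c used with h Fin.≟ h′ | trans (sym (hubList-hub h h′ c)) (used⇒listed (inj₁ h) _ used)
        ... | yes refl | _ = h′≢h refl
        ... | no _     | ()
        unfresh : ∀ t c → lookup (φ (inj₁ h)) (freshColor t c) ≢ true
        unfresh t c used with () ← trans (sym (hubList-fresh h t c)) (used⇒listed (inj₁ h) _ used)

      copy : Fin ((2 ^ a) ^ 2)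
      copy = encode hubSet

      copied : Fin 14 → Vertex
      copied k = inj₂ (copy , k)

      copyList-valid : ∀ {X} (d : Dec (∀ h → ∣ X h ∣ ≡ b)) → (∀ h → ∣ X h ∣ ≡ b) → ∀ k → copyList {X} d k ≡ innerList X k
      copyList-valid (yes _) _ k = refl
      copyList-valid (no ¬valid) valid k = contradiction valid ¬valid

      lists-inner : ∀ k → lists (copied k) ≡ innerList (decode copy) k
      lists-inner k = copyList-valid {decode copy} (valid? (decode copy))
        (λ h → trans (cong ∣_∣ (decode∘encode hubSet h)) (∣hubSet∣ h)) k

      not-shared : ∀ {x y} c → Adj x y → lookup (φ x) c ≡ true → lookup (φ y) c ≢ true
      not-shared {x} {y} c adj x∋c y∋c = disjoint adj (c , x∈p∩q⁺ (lookup⇒[]= c (φ x) x∋c , lookup⇒[]= c (φ y) y∋c))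

      -- Such a color in the list of an inner vertex comes from the guessed set of an adjacent hub.
      -- In this copy the guess is right, so the hub itself uses the color.
      no-hubColor : ∀ k h c → lookup (φ (copied k)) (hubColor h c) ≢ true
      no-hubColor k h c used = not-shared (hubColor h c) adj hub-uses used
        where
        listed : lookup (innerList (decode copy) k) (hubColor h c) ≡ true
        listed = trans (cong (λ l → lookup l (hubColor h c)) (sym (lists-inner k))) (used⇒listed (copied k) _ used)
        masked = lookup-mask (near h k) (decode copy h) c (trans (sym (innerList-hub (decode copy) k h c)) listed)
        adj : Adj (inj₁ h) (copied k)
        adj = copy , List.lose (near⇒edge h k (proj₁ masked)) (inj₁ (refl , refl))
        hub-uses : lookup (φ (inj₁ h)) (hubColor h c) ≡ true
        hub-uses = trans
          (sym (lookup∘tabulate (λ c → lookup (φ (inj₁ h)) (hubColor h c)) c))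
          (trans (cong (λ p → lookup p c) (sym (decode∘encode hubSet h))) (proj₂ masked))

      class : ∀ t → Fin (fresh t) → Subset 14
      class t c = tabulate (λ k → lookup (φ (copied k)) (freshColor t c))

      ∈class⇒used : ∀ t c {k} → k ∈ class t c → lookup (φ (copied k)) (freshColor t c) ≡ true
      ∈class⇒used t c {k} k∈ = trans
        (sym (lookup∘tabulate (λ k → lookup (φ (copied k)) (freshColor t c)) k))
        ([]=⇒lookup k∈)

      -- The vertices using one color are pairwise nonadjacent, so each clique contains at most one
      -- of them, and the lists confine them to the cover.
      ∣class∣≤ : ∀ t c → ∣ class t c ∣ ≤ length (cover t)
      ∣class∣≤ t c = ∣∣≤cover (class t c) (cover t) covered (All.map clique (cover-cliques t))
        where
        covered : ∀ {k} → k ∈ class t c → Any (k List.∈_) (cover t)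
        covered {k} k∈ = covers⇒∈ t k (trans (sym (innerList-fresh (decode copy) k t c))
          (trans (cong (λ l → lookup l (freshColor t c)) (sym (lists-inner k)))
            (used⇒listed (copied k) _ (∈class⇒used t c k∈))))
        clique : ∀ {K} → All (λ k → All (λ l → k ≡ l ⊎ Joined k l) K) K →
          ∀ k l → k List.∈ K → l List.∈ K → k ∈ class t c → l ∈ class t c → k ≡ l
        clique joined k l k∈K l∈K k∈ l∈ with All.lookup (All.lookup joined k∈K) l∈K
        ... | inj₁ k≡l = k≡l
        ... | inj₂ (inj₁ kl∈) = contradiction (∈class⇒used t c l∈)
          (not-shared _ (copy , List.lose kl∈ (inj₁ (refl , refl))) (∈class⇒used t c k∈))
        ... | inj₂ (inj₂ lk∈) = contradiction (∈class⇒used t c l∈)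
          (not-shared _ (copy , List.lose lk∈ (inj₂ (refl , refl))) (∈class⇒used t c k∈))

      ∣inner∣ : ∀ k → b ≡ sum (λ t → sum (λ c → bit (lookup (φ (copied k)) (freshColor t c))))
      ∣inner∣ k = trans (sym (size (copied k))) (trans (∣∣-by-color (φ (copied k)))
        (cong (_+ sum (λ t → sum (λ c → bit (lookup (φ (copied k)) (freshColor t c)))))
          (sum-zero λ h → sum-zero λ c → bit≡0 (no-hubColor k h c))))

      -- Counts the pairs of an inner vertex and a fresh color used there, first by vertices (b
      -- each, by `∣inner∣`), then by colors.
      double-count : 14 * b ≤ 12 * b + 5 * e
      double-count = begin
        14 * b  ≡⟨ sum-const 14 b ⟨
        sum {14} (λ k → b)  ≡⟨ sum-cong-≗ ∣inner∣ ⟩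
        sum (λ k → sum (λ t → sum (λ c → used k t c)))  ≡⟨ ∑-comm (λ k t → sum (λ c → used k t c)) ⟩
        sum (λ t → sum (λ k → sum (λ c → used k t c)))
          ≡⟨ sum-cong-≗ (λ t → ∑-comm (λ k c → used k t c)) ⟩
        sum (λ t → sum (λ c → sum (λ k → used k t c)))
          ≡⟨ sum-cong-≗ (λ t → sum-cong-≗ (λ c → ∣class∣≡sum t c)) ⟨
        sum (λ t → sum (λ c → ∣ class t c ∣))
          ≤⟨ sum-mono-≤ (λ t → sum-mono-≤ (∣class∣≤ t)) ⟩
        sum (λ t → sum {fresh t} (λ c → length (cover t)))
          ≡⟨ sum-cong-≗ (λ t → sum-const (fresh t) (length (cover t))) ⟩
        sum (λ t → fresh t * length (cover t))
          ≡⟨ sum-cong-≗ (λ t → expand (β t) (ε t) (length (cover t))) ⟩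
        sum (λ t → length (cover t) * β t * b + length (cover t) * ε t * e)
          ≡⟨ sum-linear (λ t → length (cover t) * β t) (λ t → length (cover t) * ε t) b e ⟩
        -- The two sums of cover lengths over the seven classes evaluate to 12 and 5.
        12 * b + 5 * e ∎
        where
        open ≤-Reasoning
        used : Fin 14 → ∀ t → Fin (fresh t) → ℕ
        used k t c = bit (lookup (φ (copied k)) (freshColor t c))
        ∣class∣≡sum : ∀ t c → ∣ class t c ∣ ≡ sum (λ k → used k t c)
        ∣class∣≡sum t c = trans (∣∣≡sum (class t c))
          (sum-cong-≗ λ k → cong bit (lookup∘tabulate (λ k → lookup (φ (copied k)) (freshColor t c)) k))
        expand : ∀ x y z → (x * b + y * e) * z ≡ z * x * b + z * y * e
        expand x y z = trans (*-comm _ z)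
          (trans (*-distribˡ-+ z (x * b) (y * e)) (sym (cong₂ _+_ (*-assoc z x b) (*-assoc z y e))))

-- From the double count to the bound on a / b.

module Conclusion where

  open import Data.Fin.Subset using (∣_∣)
  open import Data.Integer.Base as ℤ using (+_)
  import Data.Integer.Properties as ℤ
  open import Data.Nat.Base as ℕ using (suc; NonZero)
  import Data.Nat.Properties as ℕ
  open import Data.Product.Base using (proj₁; proj₂)
  open import Data.Rational.Base using (_/_; _<_)
  open import Data.Rational.Properties using (toℚᵘ-mono-<; toℚᵘ-fromℚᵘ)
  import Data.Rational.Unnormalised.Base as ℚᵘ
  import Data.Rational.Unnormalised.Properties as ℚᵘ
  open import Function.Base using (_∘_)
  open import Relation.Binary.PropositionalEquality
  open import Relation.Nullary.Negation.Core using (¬_)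
  open Counting using (shrink)
  open Coloring using (lists; ∣lists∣; double-count)
  open Planarity using (module Copies)

  -- A coloring from lists trimmed to `a` colors is also one from the original lists.
  choose-larger : ∀ {G a b} → Choosable G a b → ∀ {n} (L : ListAssignment G n) → (∀ v → a ℕ.≤ ∣ L v ∣) → FoldColoring G L b
  choose-larger {G} {a} choosable L a≤ = record
    { φ        = FoldColoring.φ Φ
    ; φ⊆L      = λ v → proj₁ (proj₂ (shrink (L v) a (a≤ v))) ∘ FoldColoring.φ⊆L Φ v
    ; size     = FoldColoring.size Φ
    ; disjoint = FoldColoring.disjoint Φ
    }
    where
    Φ = choosable (λ v → proj₁ (shrink (L v) a (a≤ v))) (λ v → proj₂ (proj₂ (shrink (L v) a (a≤ v))))

  -- Since `/` reduces fractions, the cross products are read off from the unnormalised rationals.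
  /-<⇒*-< : ∀ a b c d → + a / suc b < + c / suc d → a ℕ.* suc d ℕ.< c ℕ.* suc b
  /-<⇒*-< a b c d a/b<c/d = ℤ.drop‿+<+ (subst₂ ℤ._<_ (sym (ℤ.pos-* a (suc d))) (sym (ℤ.pos-* c (suc b)))
    (ℚᵘ.drop-*<* (ℚᵘ.<-respˡ-≃ (toℚᵘ-fromℚᵘ (ℚᵘ.mkℚᵘ (+ a) b))
      (ℚᵘ.<-respʳ-≃ (toℚᵘ-fromℚᵘ (ℚᵘ.mkℚᵘ (+ c) d)) (toℚᵘ-mono-< a/b<c/d)))))

  -- If a < 4 b, then e = 0 by truncated subtraction and the lists are longer than a.
  not-choosable : ∀ a b .{{_ : NonZero b}} → a ℕ.* 5 ℕ.< 22 ℕ.* b →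
    ¬ Choosable (Copies.graph ((2 ℕ.^ (4 ℕ.* b ℕ.+ (a ℕ.∸ 4 ℕ.* b))) ℕ.^ 2)) a b
  not-choosable a b 5a<22b choosable = ℕ.<⇒≱ 5e<2b (ℕ.+-cancelˡ-≤ (12 ℕ.* b) _ _
    -- Splitting 14 b as 12 b + 2 b turns the double count into 2 b ≤ 5 e.
    (subst (ℕ._≤ 12 ℕ.* b ℕ.+ 5 ℕ.* e) (ℕ.*-distribʳ-+ b 12 2) (double-count b e Φ)))
    where
    e = a ℕ.∸ 4 ℕ.* b
    Φ = choose-larger choosable (lists b e) (λ v → subst (a ℕ.≤_) (sym (∣lists∣ b e v)) (ℕ.m≤n+m∸n a (4 ℕ.* b)))
    5e<2b : 5 ℕ.* e ℕ.< 2 ℕ.* b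
    5e<2b = begin-strict
      5 ℕ.* e                           ≡⟨ ℕ.*-distribˡ-∸ 5 a (4 ℕ.* b) ⟩
      5 ℕ.* a ℕ.∸ 5 ℕ.* (4 ℕ.* b)       ≡⟨ cong₂ ℕ._∸_ (ℕ.*-comm 5 a) (sym (ℕ.*-assoc 5 4 b)) ⟩
      a ℕ.* 5 ℕ.∸ 20 ℕ.* b              <⟨
        -- The truncated difference may be 0, so strictness also requires 2 b to be nonzero.
        ℕ.m<n+o⇒m∸n<o (a ℕ.* 5) (20 ℕ.* b) {{ℕ.m*n≢0 2 b}}
          (subst (a ℕ.* 5 ℕ.<_) (ℕ.*-distribʳ-+ b 20 2) 5a<22b) ⟩
      2 ℕ.* b ∎
      where open ℕ.≤-Reasoning

open import Data.Integer.Base using (+_)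
open import Data.Nat.Base using (ℕ; NonZero; suc)
open import Data.Product.Base using (∃; _×_; _,_)
open import Data.Rational.Base using (_/_; _<_)
open import Relation.Nullary.Negation.Core using (¬_)
open Conclusion using (/-<⇒*-<; not-choosable)
open Planarity using (module Copies)

theorem3p1 : (a b : ℕ) .{{_ : NonZero a}} .{{_ : NonZero b}} →
    (+ a) / b < (+ 22) / 5 →
    ∃ λ (G : Graph) → Planar G × ¬ Choosable G a b
-- Denominators are passed as predecessors, so 4 stands for the 5 of 22 / 5.
theorem3p1 a (suc b) a/b<22/5 = Copies.graph _ , Copies.drawing _ , not-choosable a (suc b) (/-<⇒*-< a b 22 4 a/b<22/5)
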